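{- Let $(S,K,I)$ be a split graph. If $A_4(S)$ is connected, then $\Phi(S)$ is connected.
   Context: All graphs are finite and simple. A split graph is a graph $S$ whose vertex set is a disjoint union $V(S)=K\,\dot\cup\,I$ with $K$ a clique and $I$ an independent set; $(K,I)$ is called a bipartition of $S$, and $(S,K,I)$ denotes $S$ together with this fixed bipartition. A 2-switch in a graph $G$ is performed on four distinct vertices $a,b,c,d$ with $ab,cd\in E(G)$ and $ac,bd\notin E(G)$: it deletes $ab,cd$ and adds $ac,bd$; $a,b,c,d$ are said to participate in it. $A_4(G)$ is the graph with vertex set $V(G)$ in which distinct $u,v$ are adjacent iff some 2-switch on $G$ has both $u$ and $v$ among its participating vertices. For a split graph $(S,K,I)$ and distinct $u,v\in I$, $\sigma_{uv}(S)$ is the number of induced subgraphs of $S$ isomorphic to $P_4$ containing both $u$ and $v$. The factor graph $\Phi(S)$ is the loopless multigraph with vertex set $I$ having exactly $\sigma_{uv}(S)$ parallel edges between $u$ and $v$. Graph notions (connected, complete, clique, etc.) applied to $\Phi(S)$ refer to its underlying simple graph, in which $u\sim v$ iff $\sigma_{uv}(S)\ge1$. -}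

module Defs where

open import Data.Empty using (⊥-elim)
open import Data.Fin using (Fin; toℕ)
open import Data.Fin.Properties using (any?; all?) renaming (_≟_ to _≟ᶠ_)
open import Data.Fin.Subset using (Subset; inside; outside; _∈_; _∉_)
open import Data.Fin.Subset.Properties using (_∈?_)
open import Data.List using (List; []; _∷_; _++_; map; filter; length)
open import Data.List.Properties using (filter-≐)
import Data.List.Membership.Propositional as List
import Data.List.Membership.DecPropositional as DecList
open import Data.List.Relation.Unary.Unique.Propositional using (Unique)
import Data.List.Relation.Unary.Unique.DecPropositional as DecUnique
open import Data.Nat using (ℕ; zero; suc; _≤_; _≤?_)
open import Data.Nat.Properties using (1+n≢n) renaming (_≟_ to _≟ℕ_)
open import Data.Product using (Σ; ∃; _×_; _,_; proj₁; proj₂; swap)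
import Data.Sum as Sum
open import Data.Sum using (_⊎_)
open import Data.Vec using (Vec; []; _∷_; lookup; tabulate)
open import Data.Vec.Properties using (lookup∘tabulate)
open import Data.Vec.Properties.WithK using ([]=-irrelevant)
open import Function.Base using (_∘_)
open import Function.Bundles using (_↔_; _⇔_; Inverse; Equivalence; mk⇔; mk↔ₛ′)
open import Relation.Binary.Construct.Closure.ReflexiveTransitive using (Star)
open import Relation.Binary.PropositionalEquality
  using (_≡_; _≢_; refl; sym; trans; cong; subst; subst₂; ≢-sym)
open import Relation.Nullary using (¬_; Dec; yes; no)
open import Relation.Nullary.Decidable using (map′; _×-dec_; _⊎-dec_; _→-dec_; ¬?)
open import Relation.Unary using (Decidable)

-- Finite graphs are taken on Fin n, or on the vertices of Fin n lying in a
-- given Subset n.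

record Graph (V : Set) : Set₁ where
  field
    Adj        : V → V → Set
    adj?       : ∀ u v → Dec (Adj u v)
    adj-sym    : ∀ {u v} → Adj u v → Adj v u
    adj-irrefl : ∀ {v} → ¬ Adj v v

open Graph public

-- The graph with no vertices counts as connected.
Connected : ∀ {V} → Graph V → Set
Connected G = ∀ u v → Star (Adj G) u v

record _≅_ {V W : Set} (G : Graph V) (H : Graph W) : Set where
  field
    bijection : V ↔ W
    adj⇔      : ∀ u v → Adj G u v ⇔ Adj H (Inverse.to bijection u) (Inverse.to bijection v)

pathGraph : ∀ k → Graph (Fin k)
pathGraph k = record
  { Adj        = λ i j → suc (toℕ i) ≡ toℕ j ⊎ suc (toℕ j) ≡ toℕ i
  ; adj?       = λ i j → (suc (toℕ i) ≟ℕ toℕ j) ⊎-dec (suc (toℕ j) ≟ℕ toℕ i)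
  ; adj-sym    = Sum.swap
  ; adj-irrefl = Sum.[ 1+n≢n , 1+n≢n ]
  }

P₄ : Graph (Fin 4)
P₄ = pathGraph 4

Elements : ∀ {n} → Subset n → Set
Elements {n} W = Σ (Fin n) (_∈ W)

element-≡ : ∀ {n} {W : Subset n} {x y : Elements W} → proj₁ x ≡ proj₁ y → x ≡ y
element-≡ {x = v , p} {y = .v , q} refl = cong (v ,_) ([]=-irrelevant p q)

_[_] : ∀ {n} → Graph (Fin n) → (W : Subset n) → Graph (Elements W)
G [ W ] = record
  { Adj        = λ u v → Adj G (proj₁ u) (proj₁ v)
  ; adj?       = λ u v → adj? G (proj₁ u) (proj₁ v)
  ; adj-sym    = adj-sym G
  ; adj-irrefl = adj-irrefl G
  }

record SplitGraph (n : ℕ) : Set₁ where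
  field
    graph       : Graph (Fin n)
    K I         : Subset n
    cover       : ∀ v → v ∈ K ⊎ v ∈ I
    disjoint    : ∀ {v} → v ∈ K → v ∉ I
    clique      : ∀ {u v} → u ∈ K → v ∈ K → u ≢ v → Adj graph u v
    independent : ∀ {u v} → u ∈ I → v ∈ I → ¬ Adj graph u v

-- The 2-switch on a, b, c, d deletes ab, cd and adds ac, bd.
IsTwoSwitch : ∀ {V} → Graph V → V → V → V → V → Set
IsTwoSwitch G a b c d =
  Unique (a ∷ b ∷ c ∷ d ∷ []) ×
  Adj G a b × Adj G c d × ¬ Adj G a c × ¬ Adj G b d

isTwoSwitch? : ∀ {n} (G : Graph (Fin n)) a b c d → Dec (IsTwoSwitch G a b c d)
isTwoSwitch? G a b c d =
  DecUnique.unique? _≟ᶠ_ (a ∷ b ∷ c ∷ d ∷ []) ×-dec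
  adj? G a b ×-dec adj? G c d ×-dec ¬? (adj? G a c) ×-dec ¬? (adj? G b d)

A₄-Adj : ∀ {V} → Graph V → V → V → Set
A₄-Adj G u v =
  u ≢ v ×
  ∃ λ a → ∃ λ b → ∃ λ c → ∃ λ d →
    IsTwoSwitch G a b c d ×
    u List.∈ (a ∷ b ∷ c ∷ d ∷ []) ×
    v List.∈ (a ∷ b ∷ c ∷ d ∷ [])

A₄ : ∀ {n} → Graph (Fin n) → Graph (Fin n)
A₄ G = record
  { Adj        = A₄-Adj G
  ; adj?       = λ u v →
      ¬? (u ≟ᶠ v) ×-dec
      any? λ a → any? λ b → any? λ c → any? λ d →
        isTwoSwitch? G a b c d ×-dec
        DecList._∈?_ _≟ᶠ_ u (a ∷ b ∷ c ∷ d ∷ []) ×-dec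
        DecList._∈?_ _≟ᶠ_ v (a ∷ b ∷ c ∷ d ∷ [])
  ; adj-sym    = λ (u≢v , a , b , c , d , s , u∈ , v∈) →
      ≢-sym u≢v , a , b , c , d , s , v∈ , u∈
  ; adj-irrefl = λ (v≢v , _) → v≢v refl
  }

private
  anyVec? : ∀ {n} k {P : Vec (Fin n) k → Set} → Decidable P → Dec (∃ P)
  anyVec? zero    P? = map′ ([] ,_) (λ { ([] , p) → p }) (P? [])
  anyVec? (suc k) P? =
    map′ (λ (x , xs , p) → x ∷ xs , p) (λ { (x ∷ xs , p) → x , xs , p })
         (any? λ x → anyVec? k (λ xs → P? (x ∷ xs)))

  _⇔-dec_ : ∀ {A B : Set} → Dec A → Dec B → Dec (A ⇔ B)
  a? ⇔-dec b? = map′ (λ (f , g) → mk⇔ f g)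
                     (λ e → Equivalence.to e , Equivalence.from e)
                     ((a? →-dec b?) ×-dec (b? →-dec a?))

module _ {n k : ℕ} (G : Graph (Fin n)) (W : Subset n) (H : Graph (Fin k)) where

  private
    -- xs lists the vertices of W without repetition, in an order matching H.
    Lists : Vec (Fin n) k → Set
    Lists xs =
      (∀ i → lookup xs i ∈ W) ×
      (∀ v → v ∈ W → ∃ λ i → lookup xs i ≡ v) ×
      (∀ i j → lookup xs i ≡ lookup xs j → i ≡ j) ×
      (∀ i j → Adj G (lookup xs i) (lookup xs j) ⇔ Adj H i j)

    lists? : Decidable Lists
    lists? xs =
      all? (λ i → lookup xs i ∈? W) ×-dec
      all? (λ v → (v ∈? W) →-dec any? (λ i → lookup xs i ≟ᶠ v)) ×-dec
      all? (λ i → all? λ j → (lookup xs i ≟ᶠ lookup xs j) →-dec (i ≟ᶠ j)) ×-dec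
      all? (λ i → all? λ j → adj? G (lookup xs i) (lookup xs j) ⇔-dec adj? H i j)

    lists⇒≅ : ∃ Lists → (G [ W ]) ≅ H
    lists⇒≅ (xs , mem , sur , inj , adj) = record
      { bijection = mk↔ₛ′ to from to∘from from∘to
      ; adj⇔ = λ { x@(u , p) y@(v , q) →
          subst₂ (λ a b → Adj G a b ⇔ Adj H (to x) (to y))
                 (proj₂ (sur u p)) (proj₂ (sur v q)) (adj (to x) (to y)) }
      }
      where
      to : Elements W → Fin k
      to (v , p) = proj₁ (sur v p)
      from : Fin k → Elements W
      from i = lookup xs i , mem i
      to∘from : ∀ i → to (from i) ≡ i
      to∘from i = inj _ _ (proj₂ (sur (lookup xs i) (mem i)))
      from∘to : ∀ x → from (to x) ≡ x
      from∘to (v , p) = element-≡ (proj₂ (sur v p))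

    ≅⇒lists : (G [ W ]) ≅ H → ∃ Lists
    ≅⇒lists iso = tabulate f , mem , sur , inj , adj
      where
      open _≅_ iso
      open Inverse bijection using (to; from; strictlyInverseˡ; strictlyInverseʳ)
      f : Fin k → Fin n
      f = proj₁ ∘ from
      look : ∀ i → lookup (tabulate f) i ≡ f i
      look = lookup∘tabulate f
      mem : ∀ i → lookup (tabulate f) i ∈ W
      mem i = subst (_∈ W) (sym (look i)) (proj₂ (from i))
      sur : ∀ v → v ∈ W → ∃ λ i → lookup (tabulate f) i ≡ v
      sur v p = to (v , p) , trans (look _) (cong proj₁ (strictlyInverseʳ (v , p)))
      inj : ∀ i j → lookup (tabulate f) i ≡ lookup (tabulate f) j → i ≡ j
      inj i j e = trans (sym (strictlyInverseˡ i))
        (trans (cong to (element-≡ (trans (sym (look i)) (trans e (look j)))))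
               (strictlyInverseˡ j))
      adj : ∀ i j → Adj G (lookup (tabulate f) i) (lookup (tabulate f) j) ⇔ Adj H i j
      adj i j rewrite look i | look j =
        subst₂ (λ a b → Adj G (f i) (f j) ⇔ Adj H a b)
               (strictlyInverseˡ i) (strictlyInverseˡ j) (adj⇔ (from i) (from j))

  induced≅? : Dec ((G [ W ]) ≅ H)
  induced≅? = map′ lists⇒≅ ≅⇒lists (anyVec? k lists?)

-- Every subset of Fin n, exactly once.
subsets : ∀ n → List (Subset n)
subsets zero    = [] ∷ []
subsets (suc n) = map (outside ∷_) (subsets n) ++ map (inside ∷_) (subsets n)

InducedP₄Through : ∀ {n} → Graph (Fin n) → Fin n → Fin n → Subset n → Set
InducedP₄Through G u v W = ((G [ W ]) ≅ P₄) × u ∈ W × v ∈ W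

inducedP₄Through? : ∀ {n} (G : Graph (Fin n)) u v → Decidable (InducedP₄Through G u v)
inducedP₄Through? G u v W = induced≅? G W P₄ ×-dec (u ∈? W) ×-dec (v ∈? W)

-- Induced subgraphs are counted by their vertex sets.
σ : ∀ {n} → Graph (Fin n) → Fin n → Fin n → ℕ
σ {n} G u v = length (filter (inducedP₄Through? G u v) (subsets n))

σ-sym : ∀ {n} (G : Graph (Fin n)) u v → σ G u v ≡ σ G v u
σ-sym {n} G u v = cong length
  (filter-≐ (inducedP₄Through? G u v) (inducedP₄Through? G v u)
    ((λ (e , p) → e , swap p) , (λ (e , p) → e , swap p)) (subsets n))

record Multigraph (V : Set) : Set where
  field
    mult     : V → V → ℕ
    mult-sym : ∀ u v → mult u v ≡ mult v u
    loopless : ∀ v → mult v v ≡ 0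

open Multigraph public

underlying : ∀ {V} → Multigraph V → Graph V
underlying M = record
  { Adj        = λ u v → 1 ≤ mult M u v
  ; adj?       = λ u v → 1 ≤? mult M u v
  ; adj-sym    = λ {u} {v} → subst (1 ≤_) (mult-sym M u v)
  ; adj-irrefl = λ {v} 1≤m → 1≰0 (subst (1 ≤_) (loopless M v) 1≤m)
  }
  where
  1≰0 : ¬ 1 ≤ 0
  1≰0 ()

-- σ itself need not vanish on the diagonal.
Φ-mult : ∀ {n} → Graph (Fin n) → Fin n → Fin n → ℕ
Φ-mult G u v with u ≟ᶠ v
... | yes _ = 0
... | no  _ = σ G u v

Φ : ∀ {n} (S : SplitGraph n) → Multigraph (Elements (SplitGraph.I S))
Φ S = record
  { mult     = λ u v → Φ-mult G (proj₁ u) (proj₁ v)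
  ; mult-sym = λ u v → Φ-mult-sym (proj₁ u) (proj₁ v)
  ; loopless = λ v → Φ-mult-loopless (proj₁ v)
  }
  where
  G = SplitGraph.graph S
  Φ-mult-sym : ∀ u v → Φ-mult G u v ≡ Φ-mult G v u
  Φ-mult-sym u v with u ≟ᶠ v | v ≟ᶠ u
  ... | yes _   | yes _   = refl
  ... | yes u≡v | no  v≢u = ⊥-elim (v≢u (sym u≡v))
  ... | no  u≢v | yes v≡u = ⊥-elim (u≢v (sym v≡u))
  ... | no  _   | no  _   = σ-sym G u v
  Φ-mult-loopless : ∀ v → Φ-mult G v v ≡ 0
  Φ-mult-loopless v with v ≟ᶠ v
  ... | yes _   = refl
  ... | no  v≢v = ⊥-elim (v≢v refl)

{-# OPTIONS --safe #-}

-- Every 2-switch of a split graph runs along an induced path x k k′ y with x, y ∈ I and k, k′ ∈ K,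
-- so its two vertices in I are adjacent in Φ; moreover u, v ∈ I are adjacent in Φ exactly when
-- their neighbourhoods are incomparable. Consecutive edges of a walk in A₄ share a vertex v. If
-- v ∈ I, the two pairs in I share v as well. If v ∈ K, the pairs {p , q} and {p′ , q′} satisfy
-- v ∼ p , p′ and v ≁ q , q′; were they in different components of Φ, then N(q′) ⊆ N(p) and
-- N(q) ⊆ N(p′), which makes N(p) and N(p′) incomparable after all.

module Submission where

open import Defs
open import Data.Bool using (true)
open import Data.Empty using (⊥-elim)
open import Data.Fin using (Fin)
open import Data.Fin.Patterns using (0F; 1F; 2F; 3F)
open import Data.Fin.Properties using (any?; all?) renaming (_≟_ to _≟ᶠ_)
open import Data.Fin.Subset using (Subset; inside; outside; _∈_)
open import Data.List using ([]; _∷_)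
import Data.List.Membership.Propositional as List
open import Data.List.Membership.Propositional.Properties
  using (∈-++⁺ˡ; ∈-++⁺ʳ; ∈-map⁺; ∈-filter⁺; ∈-length)
open import Data.List.Relation.Unary.All as All using (All; []; _∷_)
open import Data.List.Relation.Unary.AllPairs using (_∷_)
open import Data.List.Relation.Unary.Any using (here)
open import Data.Nat using (ℕ; _≤_)
open import Data.Product using (∃; _×_; _,_; proj₁; proj₂; swap)
open import Data.Sum using (_⊎_; inj₁; inj₂)
open import Data.Vec using ([]; _∷_; tabulate)
open import Data.Vec.Properties using (lookup∘tabulate; lookup⇒[]=; []=⇒lookup)
open import Function.Base using (_∘_)
open import Function.Bundles using (_⇔_; Equivalence; mk⇔; mk↔ₛ′)
open import Function.Definitions using (Injective)
open import Relation.Binary.Construct.Closure.ReflexiveTransitive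
  using (Star; ε; _◅_; _◅◅_; reverse)
open import Relation.Binary.PropositionalEquality
  using (_≡_; _≢_; refl; sym; trans; subst; subst₂)
open import Relation.Nullary using (¬_; Dec; yes; no; does)
open import Relation.Nullary.Decidable
  using (_×-dec_; _→-dec_; ¬?; from-yes; from-no; dec-true; decidable-stable)

∈-subsets : ∀ {n} (W : Subset n) → W List.∈ subsets n
∈-subsets []            = here refl
∈-subsets (outside ∷ W) = ∈-++⁺ˡ (∈-map⁺ (outside ∷_) (∈-subsets W))
∈-subsets (inside ∷ W)  = ∈-++⁺ʳ _ (∈-map⁺ (inside ∷_) (∈-subsets W))

module _ {n k : ℕ} (f : Fin k → Fin n) where

  private
    hit? : ∀ v → Dec (∃ λ i → f i ≡ v)
    hit? v = any? (λ i → f i ≟ᶠ v)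

  image : Subset n
  image = tabulate (λ v → does (hit? v))

  ∈-image⁺ : ∀ i → f i ∈ image
  ∈-image⁺ i = lookup⇒[]= (f i) image
    (trans (lookup∘tabulate _ (f i)) (dec-true (hit? (f i)) (i , refl)))

  -- The boolean stored in `image` forgets the preimage; inspecting `hit?` again recovers it.
  ∈-image⁻ : ∀ {v} → v ∈ image → ∃ λ i → f i ≡ v
  ∈-image⁻ {v} v∈ = witness (hit? v) (trans (sym (lookup∘tabulate _ v)) ([]=⇒lookup v∈))
    where
    witness : ∀ {A : Set} (a? : Dec A) → does a? ≡ true → A
    witness (yes a) _ = a

  embedding⇒induced≅ : (G : Graph (Fin n)) (H : Graph (Fin k)) → Injective _≡_ _≡_ f →
    (∀ i j → Adj G (f i) (f j) ⇔ Adj H i j) → (G [ image ]) ≅ H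
  embedding⇒induced≅ G H inj adj = record
    { bijection = mk↔ₛ′ to from to∘from from∘to
    ; adj⇔      = λ { x@(_ , u∈) y@(_ , v∈) →
        subst₂ (λ a b → Adj G a b ⇔ Adj H (to x) (to y))
               (proj₂ (∈-image⁻ u∈)) (proj₂ (∈-image⁻ v∈)) (adj (to x) (to y)) }
    }
    where
    to : Elements image → Fin k
    to (_ , v∈) = proj₁ (∈-image⁻ v∈)
    from : Fin k → Elements image
    from i = f i , ∈-image⁺ i
    to∘from : ∀ i → to (from i) ≡ i
    to∘from i = inj (proj₂ (∈-image⁻ (∈-image⁺ i)))
    from∘to : ∀ x → from (to x) ≡ x
    from∘to (_ , v∈) = element-≡ (proj₂ (∈-image⁻ v∈))

-- Checked by exhaustion. It makes any map out of `P₄` that preserves and reflects adjacency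
-- injective, so distinctness of the vertices of a path need never be supplied.
P₄-twin-free : ∀ i j →
  (∀ l → (Adj P₄ i l → Adj P₄ j l) × (Adj P₄ j l → Adj P₄ i l)) → i ≡ j
P₄-twin-free = from-yes (all? λ i → all? λ j →
  all? (λ l → (adj? P₄ i l →-dec adj? P₄ j l) ×-dec (adj? P₄ j l →-dec adj? P₄ i l))
    →-dec (i ≟ᶠ j))

module _ {n : ℕ} (G : Graph (Fin n)) where

  induced-P₄⇒1≤σ : (f : Fin 4 → Fin n) → (∀ i j → Adj G (f i) (f j) ⇔ Adj P₄ i j) →
    ∀ i j → 1 ≤ σ G (f i) (f j)
  induced-P₄⇒1≤σ f adj i j =
    ∈-length (∈-filter⁺ (inducedP₄Through? G (f i) (f j)) (∈-subsets (image f))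
      (embedding⇒induced≅ f G P₄ inj adj , ∈-image⁺ f i , ∈-image⁺ f j))
    where
    transport : ∀ {i j} → f i ≡ f j → ∀ l → Adj P₄ i l → Adj P₄ j l
    transport {i} {j} fi≡fj l =
      Equivalence.to (adj j l) ∘ subst (λ v → Adj G v (f l)) fi≡fj ∘ Equivalence.from (adj i l)
    inj : Injective _≡_ _≡_ f
    inj {i} {j} fi≡fj = P₄-twin-free i j λ l → transport fi≡fj l , transport (sym fi≡fj) l

  path⇒1≤σ : ∀ {a b c d} → Adj G a b → Adj G b c → Adj G c d →
    ¬ Adj G a c → ¬ Adj G a d → ¬ Adj G b d → 1 ≤ σ G a d
  path⇒1≤σ {a} {b} {c} {d} ab bc cd ¬ac ¬ad ¬bd = induced-P₄⇒1≤σ f adj 0F 3F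
    where
    f : Fin 4 → Fin n
    f 0F = a
    f 1F = b
    f 2F = c
    f 3F = d
    both : ∀ {A B : Set} → A → B → A ⇔ B
    both x y = mk⇔ (λ _ → y) (λ _ → x)
    neither : ∀ {A B : Set} → ¬ A → ¬ B → A ⇔ B
    neither ¬x ¬y = mk⇔ (⊥-elim ∘ ¬x) (⊥-elim ∘ ¬y)
    flip : ∀ i j → Adj G (f i) (f j) ⇔ Adj P₄ i j → Adj G (f j) (f i) ⇔ Adj P₄ j i
    flip i j e = mk⇔ (adj-sym P₄ {i} {j} ∘ Equivalence.to e ∘ adj-sym G)
                     (adj-sym G ∘ Equivalence.from e ∘ adj-sym P₄ {j} {i})
    adj : ∀ i j → Adj G (f i) (f j) ⇔ Adj P₄ i j
    adj 0F 0F = neither (adj-irrefl G) (adj-irrefl P₄ {0F})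
    adj 0F 1F = both ab (from-yes (adj? P₄ 0F 1F))
    adj 0F 2F = neither ¬ac (from-no (adj? P₄ 0F 2F))
    adj 0F 3F = neither ¬ad (from-no (adj? P₄ 0F 3F))
    adj 1F 1F = neither (adj-irrefl G) (adj-irrefl P₄ {1F})
    adj 1F 2F = both bc (from-yes (adj? P₄ 1F 2F))
    adj 1F 3F = neither ¬bd (from-no (adj? P₄ 1F 3F))
    adj 2F 2F = neither (adj-irrefl G) (adj-irrefl P₄ {2F})
    adj 2F 3F = both cd (from-yes (adj? P₄ 2F 3F))
    adj 3F 3F = neither (adj-irrefl G) (adj-irrefl P₄ {3F})
    adj 1F 0F = flip 0F 1F (adj 0F 1F)
    adj 2F 0F = flip 0F 2F (adj 0F 2F)
    adj 2F 1F = flip 1F 2F (adj 1F 2F)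
    adj 3F 0F = flip 0F 3F (adj 0F 3F)
    adj 3F 1F = flip 1F 3F (adj 1F 3F)
    adj 3F 2F = flip 2F 3F (adj 2F 3F)

  Separates : Fin n → Fin n → Fin n → Set
  Separates v p q = Adj G v p × ¬ Adj G v q

  Incomparable : Fin n → Fin n → Set
  Incomparable p q = (∃ λ v → Separates v p q) × (∃ λ v → Separates v q p)

  separates? : ∀ v p q → Dec (Separates v p q)
  separates? v p q = adj? G v p ×-dec ¬? (adj? G v q)

  incomparable? : ∀ p q → Dec (Incomparable p q)
  incomparable? p q = any? (λ v → separates? v p q) ×-dec any? (λ v → separates? v q p)

  -- Since `v` already separates `p` from `q`, a neighbour of `q` not adjacent to `p` would complete
  -- an incomparability.
  comparable⇒⊆ : ∀ {p q v} → ¬ Incomparable p q → Separates v p q → ∀ {w} → Adj G w q → Adj G w p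
  comparable⇒⊆ {p} ¬p#q sep {w} wq =
    decidable-stable (adj? G w p) λ ¬wp → ¬p#q ((_ , sep) , (w , wq , ¬wp))

  σ⇒Φ-mult : ∀ {u v} → u ≢ v → 1 ≤ σ G u v → 1 ≤ Φ-mult G u v
  σ⇒Φ-mult {u} {v} u≢v 1≤σ with u ≟ᶠ v
  ... | yes u≡v = ⊥-elim (u≢v u≡v)
  ... | no  _   = 1≤σ

module _ {n : ℕ} (S : SplitGraph n) where
  open SplitGraph S renaming (graph to G)

  infix 4 _#_ _⇝_

  _#_ : Elements I → Elements I → Set
  p # q = Incomparable G (proj₁ p) (proj₁ q)

  _⇝_ : Elements I → Elements I → Set
  _⇝_ = Star (Adj (underlying (Φ S)))

  neighbour∈K : ∀ {u v} → v ∈ I → Adj G u v → u ∈ K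
  neighbour∈K {u} v∈I uv with cover u
  ... | inj₁ u∈K = u∈K
  ... | inj₂ u∈I = ⊥-elim (independent u∈I v∈I uv)

  -- The two witnesses are neighbours of vertices of `I`, hence lie in the clique, and `p k l q` is
  -- an induced path.
  incomparable⇒adjacent : ∀ {p q} → p # q → Adj (underlying (Φ S)) p q
  incomparable⇒adjacent {_ , p∈I} {_ , q∈I} ((k , kp , ¬kq) , (l , lq , ¬lp)) =
    σ⇒Φ-mult G (λ { refl → ¬kq kp })
      (path⇒1≤σ G (adj-sym G kp)
        (clique (neighbour∈K p∈I kp) (neighbour∈K q∈I lq) λ { refl → ¬lp kp })
        lq (¬lp ∘ adj-sym G) (independent p∈I q∈I) ¬kq)

  #⇒⇝ : ∀ {p q} → p # q → p ⇝ q
  #⇒⇝ {p} {q} p#q = incomparable⇒adjacent {p} {q} p#q ◅ ε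

  ⇝-sym : ∀ {p q} → p ⇝ q → q ⇝ p
  ⇝-sym = reverse λ {p} {q} → adj-sym (underlying (Φ S)) {p} {q}

  common-separator⇒⇝ : ∀ {v p q p′ q′} → p # q → p′ # q′ →
    Separates G v (proj₁ p) (proj₁ q) → Separates G v (proj₁ p′) (proj₁ q′) → p ⇝ p′
  common-separator⇒⇝ {_} {p} {q} {p′} {q′} p#q p′#q′ (vp , ¬vq) (vp′ , ¬vq′)
    with incomparable? G (proj₁ p) (proj₁ q′) | incomparable? G (proj₁ p′) (proj₁ q)
  -- If a crossed pair is incomparable, it gives a route of two edges, through `q′` here and through
  -- `q` in the next case.
  ... | yes p#q′ | _        = #⇒⇝ {q = q′} p#q′ ◅◅ #⇒⇝ (swap p′#q′)
  ... | no  _    | yes p′#q = #⇒⇝ {q = q} p#q ◅◅ #⇒⇝ (swap p′#q)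
  ... | no  ¬p#q′ | no ¬p′#q with p#q | p′#q′
  ...   | _ , (l , lq , ¬lp) | _ , (l′ , l′q′ , ¬l′p′) =
    -- By comparability N(q′) ⊆ N(p) and N(q) ⊆ N(p′). So `l′`, which separates `q′` from `p′`, also
    -- separates `p` from `p′`, and `l` does the converse.
    #⇒⇝ ( (l′ , comparable⇒⊆ G ¬p#q′ (vp , ¬vq′) l′q′ , ¬l′p′)
        , (l  , comparable⇒⊆ G ¬p′#q (vp′ , ¬vq) lq , ¬lp) )

  -- A vertex of `I` is its own anchor. A vertex of `K` is anchored at its neighbouring end on an
  -- induced path from `p` to `q`; it may have many anchors.
  Anchored : Fin n → Elements I → Set
  Anchored v p = v ≡ proj₁ p ⊎ ∃ λ q → p # q × Separates G v (proj₁ p) (proj₁ q)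

  -- All anchors of `v` lie in one component of `Φ S`. The mixed cases are void: `v` would be a
  -- vertex of `I` with a neighbour in `I`.
  anchors-connected : ∀ {v p p′} → Anchored v p → Anchored v p′ → p ⇝ p′
  anchors-connected {p = p} (inj₁ refl) (inj₁ v≡p′) = subst (p ⇝_) (element-≡ v≡p′) ε
  anchors-connected {p = p} {p′} (inj₁ refl) (inj₂ (_ , _ , vp′ , _)) =
    ⊥-elim (independent (proj₂ p) (proj₂ p′) vp′)
  anchors-connected {p = p} {p′} (inj₂ (_ , _ , vp , _)) (inj₁ refl) =
    ⊥-elim (independent (proj₂ p′) (proj₂ p) vp)
  anchors-connected (inj₂ (q , p#q , sep)) (inj₂ (q′ , p′#q′ , sep′)) =
    common-separator⇒⇝ {q = q} {q′ = q′} p#q p′#q′ sep sep′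

  -- Here `x` stands for its component, so that a single `x` can serve all four vertices of a
  -- switch.
  Attached : Fin n → Elements I → Set
  Attached v x = ∃ λ p → Anchored v p × p ⇝ x

  attached-self : ∀ x → Attached (proj₁ x) x
  attached-self x = x , inj₁ refl , ε

  attachments-connected : ∀ {v x y} → Attached v x → Attached v y → x ⇝ y
  attachments-connected (_ , vp , p⇝x) (_ , vq , q⇝y) =
    ⇝-sym p⇝x ◅◅ anchors-connected vp vq ◅◅ q⇝y

  -- The path is `x k l y`; `l` is anchored at `y`, which is moved to `x` along the edge between
  -- them.
  path-attached : ∀ {k l} (x y : Elements I) →
    Separates G k (proj₁ x) (proj₁ y) → Separates G l (proj₁ y) (proj₁ x) →
    Attached k x × Attached l x × Attached (proj₁ y) x
  path-attached x y k-sep l-sep =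
      (x , inj₂ (y , x#y , k-sep) , ε)
    , (y , inj₂ (x , swap x#y , l-sep) , y⇝x)
    , (y , inj₁ refl , y⇝x)
    where
    x#y : x # y
    x#y = (_ , k-sep) , (_ , l-sep)
    y⇝x : y ⇝ x
    y⇝x = #⇒⇝ (swap x#y)

  nonneighbour∈I : ∀ {u v} → v ∈ K → u ≢ v → ¬ Adj G u v → u ∈ I
  nonneighbour∈I {u} v∈K u≢v ¬uv with cover u
  ... | inj₁ u∈K = ⊥-elim (¬uv (clique u∈K v∈K u≢v))
  ... | inj₂ u∈I = u∈I

  switch-attached : ∀ {a b c d} → IsTwoSwitch G a b c d →
    ∃ λ x → All (λ v → Attached v x) (a ∷ b ∷ c ∷ d ∷ [])
  switch-attached {a} {b} {c} {d}
    (((_ ∷ a≢c ∷ _) ∷ (_ ∷ b≢d ∷ []) ∷ _) , ab , cd , ¬ac , ¬bd) with cover a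
  -- Edges and non-edges alternate around the switch, which forces `b`, `c` into `K` and `d` into
  -- `I`; the path is `a b c d`.
  ... | inj₂ a∈I = x , attached-self x ∷ bx ∷ cx ∷ dx ∷ []
    where
    d∈I = nonneighbour∈I (neighbour∈K a∈I (adj-sym G ab)) (b≢d ∘ sym) (¬bd ∘ adj-sym G)
    x = a , a∈I
    attached = path-attached x (d , d∈I) (adj-sym G ab , ¬bd) (cd , ¬ac ∘ adj-sym G)
    bx = proj₁ attached
    cx = proj₁ (proj₂ attached)
    dx = proj₂ (proj₂ attached)
  -- Now `b` and `c` are the ends in `I`, and the path is `b a d c`.
  ... | inj₁ a∈K = x , ax ∷ attached-self x ∷ cx ∷ dx ∷ []
    where
    c∈I = nonneighbour∈I a∈K (a≢c ∘ sym) (¬ac ∘ adj-sym G)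
    b∈I = nonneighbour∈I (neighbour∈K c∈I (adj-sym G cd)) b≢d ¬bd
    x = b , b∈I
    attached = path-attached x (c , c∈I) (ab , ¬ac) (adj-sym G cd , ¬bd ∘ adj-sym G)
    ax = proj₁ attached
    dx = proj₁ (proj₂ attached)
    cx = proj₂ (proj₂ attached)

  -- Each switch puts both ends of its edge in one component; the attachment of the next vertex is
  -- handed on along the walk.
  walk-connects : ∀ {u v x y} → Star (Adj (A₄ G)) u v → Attached u x → Attached v y → x ⇝ y
  walk-connects ε ux uy = attachments-connected ux uy
  walk-connects ((_ , _ , _ , _ , _ , switch , u∈ , w∈) ◅ walk) ux vy
    with switch-attached switch
  ... | _ , attached =
    attachments-connected ux (All.lookup attached u∈)
      ◅◅ walk-connects walk (All.lookup attached w∈) vy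

theorem2p4 : (n : ℕ) (S : SplitGraph n) → Connected (A₄ (SplitGraph.graph S)) → Connected (underlying (Φ S))
theorem2p4 n S conn u v =
  walk-connects S (conn (proj₁ u) (proj₁ v)) (attached-self S u) (attached-self S v)
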